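{- Let $\mathcal{M},\mathcal{N}$ be structures (in possibly different languages) and let $\tau\colon M\to N$ be a map. The following are equivalent. (1) $\tau$ extends to a Tarski system embedding $\mathcal{S}(\mathcal{M})\hookrightarrow\mathcal{S}(\mathcal{N})$. (2) $\tau$ is a trace embedding $\mathcal{M}\hookrightarrow\mathcal{N}$.
   Context: "Definable" means first order definable with parameters. A trace embedding $\mathcal{M}\hookrightarrow\mathcal{N}$ is a map $\tau\colon M\to N$ such that for every $m\ge 1$ and every $\mathcal{M}$-definable $X\subseteq M^m$ there is an $\mathcal{N}$-definable $Y\subseteq N^m$ with $X=\{(a_1,\dots,a_m)\in M^m : (\tau(a_1),\dots,\tau(a_m))\in Y\}$. A Tarski system $\mathcal{S}$ is a set $S$ together with a family $\mathcal{S}_n$ of subsets of $S^n$ for each $n\ge 1$ such that for all $1\le n<m$: (i) $\mathcal{S}_n$ is a boolean algebra of subsets of $S^n$; (ii) $\{a\}\in\mathcal{S}_1$ for each $a\in S$; (iii) $\{(a_1,a_2)\in S^2 : a_1=a_2\}\in\mathcal{S}_2$; (iv) if $\pi\colon S^m\to S^n$ is a coordinate projection then $\pi(X)\in\mathcal{S}_n$ for $X\in\mathcal{S}_m$ and $\pi^{ -1}(X)\in\mathcal{S}_m$ for $X\in\mathcal{S}_n$. For a structure $\mathcal{M}$, $\mathcal{S}(\mathcal{M})$ is the Tarski system on the set $M$ whose $n$-th family consists of all $\mathcal{M}$-definable subsets of $M^n$. An embedding $\mathcal{S}\hookrightarrow\mathcal{U}$ of Tarski systems consists of an injection $\tau\colon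 S\hookrightarrow U$ together with an injection $\tau_n\colon\mathcal{S}_n\hookrightarrow\mathcal{U}_n$ for each $n\ge 1$ such that for all $X\in\mathcal{S}_n$ and $\alpha_1,\dots,\alpha_n\in S$: $(\alpha_1,\dots,\alpha_n)\in X\Longleftrightarrow(\tau(\alpha_1),\dots,\tau(\alpha_n))\in\tau_n(X)$. -}

module Defs where

open import Data.Fin.Base using (Fin; zero; suc; lift; _↑ˡ_; _↑ʳ_)
open import Data.Nat.Base using (ℕ; zero; suc; _+_; _<_; NonZero)
open import Data.Product.Base using (Σ; ∃; _×_; _,_; proj₁; proj₂)
open import Data.Product.Function.NonDependent.Propositional using (_×-⇔_)
open import Data.Sum.Base using (_⊎_; inj₁; inj₂)
open import Data.Sum.Function.Propositional using (_⊎-⇔_)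
open import Data.Unit.Polymorphic using (⊤; tt)
open import Data.Empty.Polymorphic using (⊥)
open import Data.Vec.Base using (Vec; []; _∷_; _++_; lookup; map; tabulate)
open import Data.Vec.Properties
  using (lookup∘tabulate; tabulate∘lookup; tabulate-cong; lookup-++ˡ; lookup-++ʳ)
open import Function.Base using (_∘_)
open import Function.Bundles
  using (Func; Injection; _↣_; _⇔_; mk⇔; module Equivalence)
open import Function.Construct.Composition using (_⇔-∘_)
open import Function.Construct.Identity using (⇔-id)
open import Function.Definitions using (Injective)
open import Level using (Level; _⊔_) renaming (suc to lsuc)
open import Relation.Binary.Bundles using (Setoid)
import Relation.Binary.Construct.On as On
open import Relation.Binary.Core using (REL)
open import Relation.Binary.PropositionalEquality
  using (_≡_; refl; sym; trans; cong; cong₂)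
open import Relation.Nullary.Negation.Core using (¬_)
open import Relation.Unary using (Pred; _∈_; _≐_; _∩_; _∪_; ∁; _⊢_)
open import Relation.Unary.Polymorphic using (∅; U)
open import Relation.Unary.Relation.Binary.Equality using (≐-setoid)

open Equivalence using (to; from)

private
  variable
    ℓ : Level
    A B : Set ℓ
    m n k : ℕ

------------------------------------------------------------------------
-- Ambient set theory

-- The axiom of choice, for sets in the sense of setoids: a total relation
-- between two sets contains the graph of a function.  The function has to
-- respect the equalities of the two sets, so this is not the type-theoretic
-- distributivity of Π over Σ; as in Diaconescu's theorem it implies excluded
-- middle for all P : Set ℓ.
AxiomOfChoice : (a ℓ : Level) → Set (lsuc a ⊔ lsuc ℓ)
AxiomOfChoice a ℓ =
  (A B : Setoid a ℓ) →
  let module A = Setoid A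
      module B = Setoid B
  in
  (R : REL A.Carrier B.Carrier ℓ) →
  (∀ {x x′ y y′} → x A.≈ x′ → y B.≈ y′ → R x y → R x′ y′) →
  (∀ x → ∃ λ y → R x y) →
  Σ (Func A B) λ f → ∀ x → R x (Func.to f x)

------------------------------------------------------------------------
-- First-order structures and definability

record Language (ℓ : Level) : Set (lsuc ℓ) where
  field
    Fun : ℕ → Set ℓ
    Rel : ℕ → Set ℓ

record Structure (L : Language ℓ) : Set (lsuc ℓ) where
  open Language L
  field
    Carrier : Set ℓ
    fun     : ∀ {k} → Fun k → Vec Carrier k → Carrier
    rel     : ∀ {k} → Rel k → Pred (Vec Carrier k) ℓ

open Structure using (Carrier)

-- Terms and formulas in the variables x₀ , … , xₙ₋₁ over L expanded by a
-- constant symbol for each element of C.  A quantifier binds the variable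
-- zero of its body.
data Term (L : Language ℓ) (C : Set ℓ) (n : ℕ) : Set ℓ where
  var   : Fin n → Term L C n
  const : C → Term L C n
  app   : ∀ {k} → Language.Fun L k → (Fin k → Term L C n) → Term L C n

data Formula (L : Language ℓ) (C : Set ℓ) : ℕ → Set ℓ where
  _≈′_           : Term L C n → Term L C n → Formula L C n
  rel            : Language.Rel L k → (Fin k → Term L C n) → Formula L C n
  ⊥′ ⊤′          : Formula L C n
  ¬′_            : Formula L C n → Formula L C n
  _∧′_ _∨′_ _⇒′_ : Formula L C n → Formula L C n → Formula L C n
  ∃′_ ∀′_        : Formula L C (suc n) → Formula L C n

module _ {L : Language ℓ} (M : Structure L) where

  ⟦_⟧ : Term L (Carrier M) n → Vec (Carrier M) n → Carrier M
  ⟦ var i    ⟧ ρ = lookup ρ i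
  ⟦ const c  ⟧ ρ = c
  ⟦ app f ts ⟧ ρ = Structure.fun M f (tabulate λ i → ⟦ ts i ⟧ ρ)

  infix 4 _⊨_

  _⊨_ : Vec (Carrier M) n → Formula L (Carrier M) n → Set ℓ
  ρ ⊨ s ≈′ t   = ⟦ s ⟧ ρ ≡ ⟦ t ⟧ ρ
  ρ ⊨ rel R ts = Structure.rel M R (tabulate λ i → ⟦ ts i ⟧ ρ)
  ρ ⊨ ⊥′       = ⊥
  ρ ⊨ ⊤′       = ⊤
  ρ ⊨ ¬′ φ     = ¬ (ρ ⊨ φ)
  ρ ⊨ φ ∧′ ψ   = (ρ ⊨ φ) × (ρ ⊨ ψ)
  ρ ⊨ φ ∨′ ψ   = (ρ ⊨ φ) ⊎ (ρ ⊨ ψ)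
  ρ ⊨ φ ⇒′ ψ   = ρ ⊨ φ → ρ ⊨ ψ
  ρ ⊨ ∃′ φ     = ∃ λ x → x ∷ ρ ⊨ φ
  ρ ⊨ ∀′ φ     = ∀ x → x ∷ ρ ⊨ φ

  Definable : ∀ n → Pred (Pred (Vec (Carrier M) n) ℓ) ℓ
  Definable n X = Σ (Formula L (Carrier M) n) λ φ → ∀ a → a ∈ X ⇔ (a ⊨ φ)

IsTraceEmbedding : {L L′ : Language ℓ} (M : Structure L) (N : Structure L′) →
                   (Carrier M → Carrier N) → Set (lsuc ℓ)
IsTraceEmbedding {ℓ} M N τ =
  ∀ m → .{{_ : NonZero m}} →
  (X : Pred (Vec (Carrier M) m) ℓ) → Definable M m X →
  Σ (Pred (Vec (Carrier N) m) ℓ) λ Y → Definable N m Y × X ≐ (map τ ⊢ Y)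

------------------------------------------------------------------------
-- Tarski systems

-- The coordinate projection (a₁ , … , aₘ) ↦ (a_ι₁ , … , a_ιₙ).
proj : (Fin n → Fin m) → Vec A m → Vec A n
proj ι a = tabulate (lookup a ∘ ι)

image : {A B : Set ℓ} → (A → B) → Pred A ℓ → Pred B ℓ
image f X b = ∃ λ a → a ∈ X × f a ≡ b

-- Subsets are predicates and equality of subsets is _≐_, which a family of
-- subsets must respect.
record IsBooleanAlgebraOfSubsets {A : Set ℓ} (𝒟 : Pred (Pred A ℓ) ℓ) : Set (lsuc ℓ) where
  field
    resp : ∀ {X Y} → X ≐ Y → X ∈ 𝒟 → Y ∈ 𝒟
    ∅-∈  : ∅ ∈ 𝒟
    U-∈  : U ∈ 𝒟
    ∩-∈  : ∀ {X Y} → X ∈ 𝒟 → Y ∈ 𝒟 → X ∩ Y ∈ 𝒟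
    ∪-∈  : ∀ {X Y} → X ∈ 𝒟 → Y ∈ 𝒟 → X ∪ Y ∈ 𝒟
    ∁-∈  : ∀ {X} → X ∈ 𝒟 → ∁ X ∈ 𝒟

record TarskiSystem (ℓ : Level) : Set (lsuc ℓ) where
  field
    S : Set ℓ
    𝒟 : ∀ n → .{{NonZero n}} → Pred (Pred (Vec S n) ℓ) ℓ
    boolean   : ∀ n → .{{_ : NonZero n}} → IsBooleanAlgebraOfSubsets (𝒟 n)
    singleton : ∀ a → (λ v → v ≡ a ∷ []) ∈ 𝒟 1
    diagonal  : (λ v → lookup v zero ≡ lookup v (suc zero)) ∈ 𝒟 2
    image-∈   : ∀ {n m} .{{_ : NonZero n}} .{{_ : NonZero m}} → n < m →
                (ι : Fin n → Fin m) → Injective _≡_ _≡_ ι →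
                ∀ {X} → X ∈ 𝒟 m → image (proj ι) X ∈ 𝒟 n
    preimage-∈ : ∀ {n m} .{{_ : NonZero n}} .{{_ : NonZero m}} → n < m →
                 (ι : Fin n → Fin m) → Injective _≡_ _≡_ ι →
                 ∀ {X} → X ∈ 𝒟 n → (proj ι ⊢ X) ∈ 𝒟 m

  -- 𝒟 n as a set of subsets: the proof of membership in 𝒟 n is disregarded.
  members : ∀ n → .{{NonZero n}} → Setoid (lsuc ℓ) ℓ
  members n = On.setoid {B = Σ (Pred (Vec S n) ℓ) (𝒟 n)} (≐-setoid (Vec S n) ℓ) proj₁

record Embedding (𝒮 𝒰 : TarskiSystem ℓ) : Set (lsuc ℓ) where
  private
    module 𝒮 = TarskiSystem 𝒮
    module 𝒰 = TarskiSystem 𝒰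
  field
    τ  : 𝒮.S ↣ 𝒰.S
    τₙ : ∀ n → .{{_ : NonZero n}} → Injection (𝒮.members n) (𝒰.members n)
    τ-∈ : ∀ n → .{{_ : NonZero n}} →
          (X : Setoid.Carrier (𝒮.members n)) (α : Vec 𝒮.S n) →
          α ∈ proj₁ X ⇔ map (Injection.to τ) α ∈ proj₁ (Injection.to (τₙ n) X)

ExtendsToEmbedding : (𝒮 𝒰 : TarskiSystem ℓ) →
                     (TarskiSystem.S 𝒮 → TarskiSystem.S 𝒰) → Set (lsuc ℓ)
ExtendsToEmbedding 𝒮 𝒰 τ =
  Σ (Embedding 𝒮 𝒰) λ e → ∀ a → Injection.to (Embedding.τ e) a ≡ τ a

------------------------------------------------------------------------
-- The Tarski system of definable sets

module _ {L : Language ℓ} {C : Set ℓ} where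

  renameₜ : (Fin n → Fin m) → Term L C n → Term L C m
  renameₜ ι (var i)    = var (ι i)
  renameₜ ι (const c)  = const c
  renameₜ ι (app f ts) = app f λ i → renameₜ ι (ts i)

  rename : (Fin n → Fin m) → Formula L C n → Formula L C m
  rename ι (s ≈′ t)   = renameₜ ι s ≈′ renameₜ ι t
  rename ι (rel R ts) = rel R λ i → renameₜ ι (ts i)
  rename ι ⊥′         = ⊥′
  rename ι ⊤′         = ⊤′
  rename ι (¬′ φ)     = ¬′ rename ι φ
  rename ι (φ ∧′ ψ)   = rename ι φ ∧′ rename ι ψ
  rename ι (φ ∨′ ψ)   = rename ι φ ∨′ rename ι ψ
  rename ι (φ ⇒′ ψ)   = rename ι φ ⇒′ rename ι ψ
  rename ι (∃′ φ)     = ∃′ rename (lift 1 ι) φ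
  rename ι (∀′ φ)     = ∀′ rename (lift 1 ι) φ

  ∃^ : ∀ k → Formula L C (k + n) → Formula L C n
  ∃^ zero    φ = φ
  ∃^ (suc k) φ = ∃^ k (∃′ φ)

  ⋀ : ∀ k → (Fin k → Formula L C n) → Formula L C n
  ⋀ zero    φ = ⊤′
  ⋀ (suc k) φ = φ zero ∧′ ⋀ k (φ ∘ suc)

module _ {L : Language ℓ} (M : Structure L) where

  private
    ¬-⇔ : {P Q : Set ℓ} → P ⇔ Q → (¬ P) ⇔ (¬ Q)
    ¬-⇔ e = mk⇔ (λ ¬p q → ¬p (from e q)) (λ ¬q p → ¬q (to e p))

    →-⇔ : {P P′ Q Q′ : Set ℓ} → P ⇔ P′ → Q ⇔ Q′ → (P → Q) ⇔ (P′ → Q′)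
    →-⇔ e f = mk⇔ (λ g → to f ∘ g ∘ from e) (λ g → from f ∘ g ∘ to e)

    ∃-⇔ : {P Q : A → Set ℓ} → (∀ x → P x ⇔ Q x) → ∃ P ⇔ ∃ Q
    ∃-⇔ e = mk⇔ (λ (x , p) → x , to (e x) p) (λ (x , q) → x , from (e x) q)

    ∀-⇔ : {P Q : A → Set ℓ} → (∀ x → P x ⇔ Q x) → (∀ x → P x) ⇔ (∀ x → Q x)
    ∀-⇔ e = mk⇔ (λ p x → to (e x) (p x)) (λ q x → from (e x) (q x))

    ≡⇒⇔ : {P Q : Set ℓ} → P ≡ Q → P ⇔ Q
    ≡⇒⇔ refl = ⇔-id _

    Agree : (Fin n → Fin m) → Vec (Carrier M) n → Vec (Carrier M) m → Set ℓ
    Agree ι ρ σ = ∀ i → lookup ρ i ≡ lookup σ (ι i)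

    Agree-lift : (ι : Fin n → Fin m) (ρ : Vec (Carrier M) n) (σ : Vec (Carrier M) m) →
                 Agree ι ρ σ → ∀ x →
                 Agree (lift 1 ι) (x ∷ ρ) (x ∷ σ)
    Agree-lift ι ρ σ eq x zero    = refl
    Agree-lift ι ρ σ eq x (suc i) = eq i

    ⟦renameₜ⟧ : (ι : Fin n → Fin m) (ρ : Vec (Carrier M) n) (σ : Vec (Carrier M) m) →
                Agree ι ρ σ → (t : Term L (Carrier M) n) →
                ⟦_⟧ M t ρ ≡ ⟦_⟧ M (renameₜ ι t) σ
    ⟦renameₜ⟧ ι ρ σ eq (var i)    = eq i
    ⟦renameₜ⟧ ι ρ σ eq (const c)  = refl
    ⟦renameₜ⟧ ι ρ σ eq (app f ts) =
      cong (Structure.fun M f) (tabulate-cong λ i → ⟦renameₜ⟧ ι ρ σ eq (ts i))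

    ⊨-rename : (ι : Fin n → Fin m) (ρ : Vec (Carrier M) n) (σ : Vec (Carrier M) m) →
               Agree ι ρ σ → (φ : Formula L (Carrier M) n) →
               (_⊨_ M ρ φ) ⇔ (_⊨_ M σ (rename ι φ))
    ⊨-rename ι ρ σ eq (s ≈′ t)   =
      ≡⇒⇔ (cong₂ _≡_ (⟦renameₜ⟧ ι ρ σ eq s) (⟦renameₜ⟧ ι ρ σ eq t))
    ⊨-rename ι ρ σ eq (rel R ts) =
      ≡⇒⇔ (cong (Structure.rel M R) (tabulate-cong λ i → ⟦renameₜ⟧ ι ρ σ eq (ts i)))
    ⊨-rename ι ρ σ eq ⊥′         = ⇔-id _
    ⊨-rename ι ρ σ eq ⊤′         = ⇔-id _
    ⊨-rename ι ρ σ eq (¬′ φ)     = ¬-⇔ (⊨-rename ι ρ σ eq φ)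
    ⊨-rename ι ρ σ eq (φ ∧′ ψ)   = ⊨-rename ι ρ σ eq φ ×-⇔ ⊨-rename ι ρ σ eq ψ
    ⊨-rename ι ρ σ eq (φ ∨′ ψ)   = ⊨-rename ι ρ σ eq φ ⊎-⇔ ⊨-rename ι ρ σ eq ψ
    ⊨-rename ι ρ σ eq (φ ⇒′ ψ)   = →-⇔ (⊨-rename ι ρ σ eq φ) (⊨-rename ι ρ σ eq ψ)
    ⊨-rename ι ρ σ eq (∃′ φ)     =
      ∃-⇔ λ x → ⊨-rename (lift 1 ι) (x ∷ ρ) (x ∷ σ) (Agree-lift ι ρ σ eq x) φ
    ⊨-rename ι ρ σ eq (∀′ φ)     =
      ∀-⇔ λ x → ⊨-rename (lift 1 ι) (x ∷ ρ) (x ∷ σ) (Agree-lift ι ρ σ eq x) φ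

    ⊨-∃^ : ∀ k (ρ : Vec (Carrier M) n) (φ : Formula L (Carrier M) (k + n)) →
           (∃ λ (v : Vec (Carrier M) k) → _⊨_ M (v ++ ρ) φ) ⇔ (_⊨_ M ρ (∃^ k φ))
    ⊨-∃^ zero    ρ φ = mk⇔ (λ { ([] , p) → p }) (λ p → [] , p)
    ⊨-∃^ (suc k) ρ φ =
      mk⇔ (λ { (x ∷ v , p) → to (⊨-∃^ k ρ (∃′ φ)) (v , x , p) })
          (λ p → let (v , x , q) = from (⊨-∃^ k ρ (∃′ φ)) p in x ∷ v , q)

    ⊨-⋀ : ∀ k (ρ : Vec (Carrier M) n) (φ : Fin k → Formula L (Carrier M) n) →
          (∀ i → _⊨_ M ρ (φ i)) ⇔ (_⊨_ M ρ (⋀ k φ))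
    ⊨-⋀ zero    ρ φ = mk⇔ (λ _ → tt) (λ _ ())
    ⊨-⋀ (suc k) ρ φ =
      mk⇔ (λ p → p zero , to (⊨-⋀ k ρ (φ ∘ suc)) (p ∘ suc))
          (λ { (p , q) zero → p ; (p , q) (suc i) → from (⊨-⋀ k ρ (φ ∘ suc)) q i })

    preimage : (ι : Fin n → Fin m) {X : Pred (Vec (Carrier M) n) ℓ} →
               Definable M n X → Definable M m (proj ι ⊢ X)
    preimage ι (φ , e) = rename ι φ , λ a →
      ⊨-rename ι (proj ι a) a (lookup∘tabulate (lookup a ∘ ι)) φ ⇔-∘ e (proj ι a)

    -- b ∈ π(X) is expressed by ∃ a . φ(a) ∧ ⋀ᵢ a_ι(i) = bᵢ.
    directImage : (ι : Fin n → Fin m) {X : Pred (Vec (Carrier M) m) ℓ} →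
                  Definable M m X → Definable M n (image (proj ι) X)
    directImage {n = n} {m = m} ι {X} (φ , e) =
      ∃^ m (rename (_↑ˡ n) φ ∧′ ⋀ n ψ) , λ b →
      ⊨-∃^ m b (rename (_↑ˡ n) φ ∧′ ⋀ n ψ) ⇔-∘
      ∃-⇔ λ a →
        (⊨-rename (_↑ˡ n) a (a ++ b) (λ i → sym (lookup-++ˡ a b i)) φ ⇔-∘ e a)
          ×-⇔ (⊨-⋀ n (a ++ b) ψ ⇔-∘ graph a b)
      where
      ψ : Fin n → Formula L (Carrier M) (m + n)
      ψ i = var (ι i ↑ˡ n) ≈′ var (m ↑ʳ i)

      graph : ∀ a b → (proj ι a ≡ b) ⇔ (∀ i → _⊨_ M (a ++ b) (ψ i))
      graph a b = mk⇔
        (λ { refl i → trans (lookup-++ˡ a b (ι i))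
               (trans (sym (lookup∘tabulate (lookup a ∘ ι) i)) (sym (lookup-++ʳ a b i))) })
        (λ p → trans (tabulate-cong λ i → trans (sym (lookup-++ˡ a b (ι i)))
                       (trans (p i) (lookup-++ʳ a b i)))
                     (tabulate∘lookup b))

  𝒮 : TarskiSystem ℓ
  𝒮 = record
    { S          = Carrier M
    ; 𝒟          = λ n → Definable M n
    ; boolean    = λ n → record
      { resp = λ (X⊆Y , Y⊆X) (φ , e) → φ , λ a → e a ⇔-∘ mk⇔ Y⊆X X⊆Y
      ; ∅-∈  = ⊥′ , λ a → ⇔-id _
      ; U-∈  = ⊤′ , λ a → ⇔-id _
      ; ∩-∈  = λ (φ , e) (ψ , f) → φ ∧′ ψ , λ a → e a ×-⇔ f a
      ; ∪-∈  = λ (φ , e) (ψ , f) → φ ∨′ ψ , λ a → e a ⊎-⇔ f a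
      ; ∁-∈  = λ (φ , e) → ¬′ φ , λ a → ¬-⇔ (e a)
      }
    ; singleton  = λ a → var zero ≈′ const a ,
                   λ { (x ∷ []) → mk⇔ (λ { refl → refl }) (λ { refl → refl }) }
    ; diagonal   = var zero ≈′ var (suc zero) , λ a → ⇔-id _
    ; image-∈    = λ _ ι _ → directImage ι
    ; preimage-∈ = λ _ ι _ → preimage ι
    }

{-# OPTIONS --safe #-}
module Submission where

open import Defs
open import Level using (Level) renaming (suc to lsuc)
open import Function.Bundles using (_⇔_)
open import Data.Nat.Base using (NonZero)
open import Data.Product.Base using (Σ; _,_; proj₁; proj₂)
open import Data.Vec.Base using ([]; _∷_; map)
open import Data.Vec.Properties using (map-cong)
open import Function.Bundles using (Func; Injection; mk⇔; module Equivalence)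
open import Function.Definitions using (Injective)
open import Relation.Binary.PropositionalEquality using (_≡_; refl; cong; subst; sym)
open import Relation.Unary using (Pred; _≐_; _⊢_)
open import Relation.Unary.Properties using (≐-sym; ≐-trans)

private
  variable
    ℓ : Level

-- The condition `τ-∈` says exactly that `X` is the preimage under `map τ` of `τₙ(X)`. An embedding
-- therefore already supplies the definable sets that a trace embedding asks for. Conversely,
-- choosing one such set for each `X` defines `τₙ`, which is injective because each `X` is recovered
-- from its chosen set as a preimage. Injectivity of `τ` comes from tracing the diagonal.

⊢-cong : {A B : Set ℓ} (f : A → B) {Y Y′ : Pred B ℓ} → Y ≐ Y′ → (f ⊢ Y) ≐ (f ⊢ Y′)
⊢-cong f (Y⊆Y′ , Y′⊆Y) = Y⊆Y′ , Y′⊆Y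

module _ {L L′ : Language ℓ} (M : Structure L) (N : Structure L′)
         {τ : Structure.Carrier M → Structure.Carrier N} where

  open Structure using (Carrier)

  extends⇒trace : ExtendsToEmbedding (𝒮 M) (𝒮 N) τ → IsTraceEmbedding M N τ
  extends⇒trace (e , e≗τ) m X X-def =
    proj₁ Y , proj₂ Y ,
    -- The point map of `e` agrees with `τ` only pointwise, so membership is transported along
    -- `map-cong`.
    (λ {a} a∈X → subst (proj₁ Y) (map-cong e≗τ a) (Equivalence.to (τ-∈ m (X , X-def) a) a∈X)) ,
    (λ {a} τa∈Y → Equivalence.from (τ-∈ m (X , X-def) a)
                    (subst (proj₁ Y) (sym (map-cong e≗τ a)) τa∈Y))
    where
    open Embedding e using (τₙ; τ-∈)
    Y = Injection.to (τₙ m) (X , X-def)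

  -- A set whose trace is the diagonal of M contains (τ a , τ a) = (τ a , τ b)
  -- as soon as τ a = τ b.
  trace⇒injective : IsTraceEmbedding M N τ → Injective _≡_ _≡_ τ
  trace⇒injective trace {a} {b} τa≡τb
    with trace 2 _ (TarskiSystem.diagonal (𝒮 M))
  ... | Y , _ , Δ⊆Y , Y⊆Δ =
    Y⊆Δ {a ∷ b ∷ []} (subst (λ y → Y (τ a ∷ y ∷ [])) τa≡τb (Δ⊆Y {a ∷ a ∷ []} refl))

  trace⇒extends : AxiomOfChoice (lsuc ℓ) ℓ →
                  IsTraceEmbedding M N τ → ExtendsToEmbedding (𝒮 M) (𝒮 N) τ
  trace⇒extends choice trace = e , λ _ → refl
    where
    chosen : ∀ n → .{{_ : NonZero n}} →
             Σ (Func (TarskiSystem.members (𝒮 M) n) (TarskiSystem.members (𝒮 N) n)) λ f →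
             ∀ X → proj₁ X ≐ (map τ ⊢ proj₁ (Func.to f X))
    -- The witness from `trace` may depend on the formula defining `X`. Choice over sets modulo `≐`
    -- makes it depend on the set alone, as `τₙ` must.
    chosen n = choice (TarskiSystem.members (𝒮 M) n) (TarskiSystem.members (𝒮 N) n)
      (λ X Y → proj₁ X ≐ (map τ ⊢ proj₁ Y))
      (λ X≐X′ Y≐Y′ X≐τ⊢Y → ≐-trans (≐-sym X≐X′) (≐-trans X≐τ⊢Y (⊢-cong (map τ) Y≐Y′)))
      (λ (X , X-def) → let (Y , Y-def , X≐τ⊢Y) = trace n X X-def in (Y , Y-def) , X≐τ⊢Y)

    e : Embedding (𝒮 M) (𝒮 N)
    e = record
      { τ   = record { to = τ ; cong = cong τ ; injective = trace⇒injective trace }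
      ; τₙ  = λ n → let (f , X≐τ⊢fX) = chosen n in record
        { to        = Func.to f
        ; cong      = Func.cong f
        -- `X` and `X′` are the preimages of `f X` and `f X′`, and preimages respect `≐`.
        ; injective = λ {X} {X′} fX≐fX′ →
            ≐-trans (X≐τ⊢fX X) (≐-trans (⊢-cong (map τ) fX≐fX′) (≐-sym (X≐τ⊢fX X′)))
        }
      ; τ-∈ = λ n X α → let (X⊆ , ⊆X) = proj₂ (chosen n) X in mk⇔ X⊆ ⊆X
      }

proposition1p12 : ∀ {ℓ : Level} → AxiomOfChoice (lsuc ℓ) ℓ →
    {L L′ : Language ℓ} (M : Structure L) (N : Structure L′)
    (τ : Structure.Carrier M → Structure.Carrier N) →
    ExtendsToEmbedding (𝒮 M) (𝒮 N) τ ⇔ IsTraceEmbedding M N τ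
proposition1p12 choice M N τ = mk⇔ (extends⇒trace M N) (trace⇒extends M N choice)
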